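{- Let $G$ be a connected simple graph on $n$ vertices with Laplacian $L$. If $\mu$ is an integer with $\mu\notin[0,n+1]$, then $L$ is not $\mu$-collapsed, i.e. the matrix $L-\mu\,\mathrm{Id}$ is spread.
   Context: A graph is simple if any two distinct vertices are joined by at most one edge (no loops). The Laplacian $L=(\ell_{ij})\in M_n(\mathbb{Z})$ has $\ell_{ii}$ equal to the degree of $v_i$ and $\ell_{ij}=-1$ if $v_i,v_j$ are adjacent, $0$ otherwise ($i\neq j$). For $M\in M_n(\mathbb{Z})$, let $\mathrm{Im}(M)$ be the $\mathbb{Z}$-span of its columns; $M$ is spread if the quotient map $\mathbb{Z}^n\to\mathbb{Z}^n/\mathrm{Im}(M)$ is injective on the standard basis $\{e_1,\dots,e_n\}$ (equivalently, $e_i-e_j\notin\mathrm{Im}(M)$ for all $i\neq j$). For an integer $\mu$, $M$ is $\mu$-collapsed if $M-\mu\,\mathrm{Id}$ is not spread. -}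

module Defs where

open import Level using (0ℓ)
open import Data.Bool using (if_then_else_)
open import Data.Fin using (Fin; _≟_)
open import Data.Integer using (ℤ; +_; 0ℤ; 1ℤ; -1ℤ; _-_; _*_; +-0-rawMonoid)
open import Data.Nat using (ℕ)
open import Data.Product using (Σ-syntax)
open import Data.Vec using (allFin; count)
open import Data.Vec.Functional using (Vector)
open import Function.Definitions using (Injective)
open import Relation.Binary.Core using (Rel)
open import Relation.Binary.Definitions using (Decidable; Irreflexive; Symmetric)
open import Relation.Binary.Construct.Closure.ReflexiveTransitive using (Star)
open import Relation.Binary.PropositionalEquality using (_≡_)
open import Relation.Nullary using (¬_; does)
open import Algebra.Definitions.RawMonoid +-0-rawMonoid using (sum)

Matrix : ℕ → Set
Matrix n = Vector (Vector ℤ n) n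

e : ∀ {n} → Fin n → Vector ℤ n
e i j = if does (i ≟ j) then 1ℤ else 0ℤ

Id : ∀ {n} → Matrix n
Id = e

infixl 6 _⊖_
infixl 7 _·_

_⊖_ : ∀ {n} → Matrix n → Matrix n → Matrix n
(M ⊖ N) i j = M i j - N i j

_·_ : ∀ {n} → ℤ → Matrix n → Matrix n
(μ · M) i j = μ * M i j

-- M i j is the entry in row i and column j, so this says x = Σⱼ cⱼ (column j).
_∈Im_ : ∀ {n} → Vector ℤ n → Matrix n → Set
_∈Im_ {n} x M = Σ[ c ∈ Vector ℤ n ] ∀ i → x i ≡ sum (λ j → c j * M i j)

-- Equality of the classes of x and y in the quotient ℤⁿ / Im(M).
_≈_mod-Im_ : ∀ {n} → Vector ℤ n → Vector ℤ n → Matrix n → Set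
x ≈ y mod-Im M = (λ k → x k - y k) ∈Im M

-- The quotient is the setoid (ℤⁿ, _≈_mod-Im M), whose projection is the
-- identity on representatives; its restriction to the standard basis is e.
Spread : ∀ {n} → Matrix n → Set
Spread M = Injective _≡_ (λ x y → x ≈ y mod-Im M) e

Collapsed : ∀ {n} → ℤ → Matrix n → Set
Collapsed μ M = ¬ Spread (M ⊖ μ · Id)

record SimpleGraph (n : ℕ) : Set₁ where
  field
    Adj    : Rel (Fin n) 0ℓ
    adj?   : Decidable Adj
    symm   : Symmetric Adj
    irrefl : Irreflexive _≡_ Adj

  degree : Fin n → ℕ
  degree i = count (adj? i) (allFin n)

  Connected : Set
  Connected = ∀ i j → Star Adj i j

  laplacian : Matrix n
  laplacian i j =
    if does (i ≟ j) then + degree i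
    else if does (adj? i j) then -1ℤ
    else 0ℤ

{-# OPTIONS --safe #-}
-- Δ w is the Laplacian of the weighted graph w. If (L - μ) c = eᵢ - eⱼ
-- with i ≠ j, then summing the coordinates gives μ Σ c = 0, hence Σ c = 0 for μ ≠ 0.
-- At a vertex k where c is maximal, Δ w c k ≥ 0 for every nonnegative weight w.
--   * μ < 0: max c ≤ 0, since otherwise μ = -1, max c = 1, c attains its maximum only
--     at i, and the vanishing of Δ w c i forces c to be maximal at the neighbours of i too.
--   * μ ≥ n + 2: on vectors of sum zero the Laplacian of the complement is n - L, so
--     (μ - n) max c ≤ 1 and again max c ≤ 0.
-- As Σ c = 0, it follows that c = 0, which is absurd.
module Submission where

open import Defs
open import Data.Integer using (ℤ; +_; 0ℤ; _≤_)
open import Data.Nat using (ℕ; suc)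
open import Data.Product using (_×_)
open import Relation.Nullary using (¬_)

open import Data.Bool using (true; false; if_then_else_)
open import Data.Fin using (Fin; zero; suc; _≟_)
open import Data.Integer using (1ℤ; -1ℤ; _+_; _-_; -_; _*_; _<_; +≤+; -≤+; +<+; nonNegative)
open import Data.Integer.Properties hiding (_≟_)
open import Data.Integer.Tactic.RingSolver using (solve-∀)
open import Data.Nat using (zero; s≤s; z≤n)
open import Data.Product using (∃-syntax; _,_)
open import Data.Sum using (inj₁; inj₂)
open import Data.Vec as Vec using (count)
open import Data.Vec.Functional using (Vector)
open import Function using (_∘_; id)
open import Relation.Binary.Construct.Closure.ReflexiveTransitive using (Star; ε; _◅_)
open import Relation.Binary.PropositionalEquality using (_≡_; _≢_; refl; sym; trans; cong; cong₂; subst; module ≡-Reasoning)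
open import Relation.Nullary using (does; yes; no; contradiction)
open import Relation.Unary using (Decidable)
open import Algebra.Properties.CommutativeMonoid.Sum +-0-commutativeMonoid using (sum; sum-cong-≗; sum-replicate-zero; ∑-comm)
open import Algebra.Properties.Semiring.Sum +-*-semiring using (*-distribˡ-sum; *-distribʳ-sum)

private variable
  n : ℕ

-- Finite sums of integers.

sum-- : (f g : Vector ℤ n) → sum (λ i → f i - g i) ≡ sum f - sum g
sum-- {zero}  f g = refl
sum-- {suc n} f g = trans (cong (_+_ (f zero - g zero)) (sum-- (f ∘ suc) (g ∘ suc)))
                          (rearrange (f zero) (g zero) _ _)
  where
  rearrange : ∀ a b x y → (a - b) + (x - y) ≡ (a + x) - (b + y)
  rearrange = solve-∀

sum-zero : {f : Vector ℤ n} → (∀ i → f i ≡ 0ℤ) → sum f ≡ 0ℤ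
sum-zero {n} f≡0 = trans (sum-cong-≗ f≡0) (sum-replicate-zero n)

sum-const : ∀ n x → sum {n} (λ _ → x) ≡ + n * x
sum-const zero    x = refl
sum-const (suc n) x = trans (cong (_+_ x) (sum-const n x)) (sym (suc-* (+ n) x))

sum-e : (k : Fin n) (f : Vector ℤ n) → sum (λ l → e k l * f l) ≡ f k
sum-e {suc n} zero    f = trans (cong₂ _+_ (*-identityˡ (f zero)) (sum-replicate-zero n)) (+-identityʳ (f zero))
sum-e {suc n} (suc k) f = trans (+-identityˡ _) (sum-e k (f ∘ suc))

sum-nonneg : {f : Vector ℤ n} → (∀ i → 0ℤ ≤ f i) → 0ℤ ≤ sum f
sum-nonneg {zero}  f≥0 = ≤-refl
sum-nonneg {suc n} f≥0 = +-mono-≤ (f≥0 zero) (sum-nonneg (f≥0 ∘ suc))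

term≤sum : {f : Vector ℤ n} → (∀ i → 0ℤ ≤ f i) → ∀ i → f i ≤ sum f
term≤sum {f = f} f≥0 zero    = subst (_≤ sum f) (+-identityʳ _) (+-monoʳ-≤ (f zero) (sum-nonneg (f≥0 ∘ suc)))
term≤sum {f = f} f≥0 (suc i) = subst (_≤ sum f) (+-identityˡ _) (+-mono-≤ (f≥0 zero) (term≤sum (f≥0 ∘ suc) i))

nonneg-sum≤0⇒zero : {f : Vector ℤ n} → (∀ i → 0ℤ ≤ f i) → sum f ≤ 0ℤ → ∀ i → f i ≡ 0ℤ
nonneg-sum≤0⇒zero f≥0 sum≤0 i = ≤-antisym (≤-trans (term≤sum f≥0 i) sum≤0) (f≥0 i)

-- Maxima of integer vectors.

IsMax : Vector ℤ n → Fin n → Set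
IsMax c k = ∀ l → c l ≤ c k

argmax : (c : Vector ℤ (suc n)) → ∃[ k ] IsMax c k
argmax {zero}  c = zero , λ { zero → ≤-refl }
argmax {suc n} c with argmax (c ∘ suc)
... | k , max with ≤-total (c zero) (c (suc k))
...   | inj₁ c₀≤cₖ = suc k , λ { zero → c₀≤cₖ ; (suc l) → max l }
...   | inj₂ cₖ≤c₀ = zero , λ { zero → ≤-refl ; (suc l) → ≤-trans (max l) cₖ≤c₀ }

-- The index excludes `n = 0`, where no maximum exists; callers pass a vertex at hand.
argmax′ : Fin n → (c : Vector ℤ n) → ∃[ k ] IsMax c k
argmax′ {suc n} _ c = argmax c

-- The numbers `- c l` are nonnegative and add up to zero, so each of them vanishes.
max≤0∧sum≡0⇒zero : {c : Vector ℤ n} {k : Fin n} → IsMax c k → c k ≤ 0ℤ → sum c ≡ 0ℤ → ∀ l → c l ≡ 0ℤ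
max≤0∧sum≡0⇒zero {n} {c} {k} max ck≤0 Σc≡0 l =
  neg-injective (trans (sym (+-identityˡ _)) (nonneg-sum≤0⇒zero
    (λ l → i≤j⇒0≤j-i (≤-trans (max l) ck≤0))
    (≤-reflexive (trans (sum-- (λ _ → 0ℤ) c) (cong₂ _-_ (sum-replicate-zero n) Σc≡0))) l))

-- Laplacians of weighted graphs.

Δ : Matrix n → Vector ℤ n → Vector ℤ n
Δ w c k = sum (λ l → w k l * (c k - c l))

Δ-split : (w : Matrix n) (c : Vector ℤ n) (k : Fin n) →
          Δ w c k ≡ sum (λ l → w k l * c k) - sum (λ l → w k l * c l)
Δ-split w c k = trans (sum-cong-≗ (λ l → expand (w k l) (c k) (c l)))
                      (sum-- (λ l → w k l * c k) (λ l → w k l * c l))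
  where
  expand : ∀ a x y → a * (x - y) ≡ a * x - a * y
  expand = solve-∀

Δ-term-nonneg : {w : Matrix n} {c : Vector ℤ n} → (∀ k l → 0ℤ ≤ w k l) →
                ∀ {k} → IsMax c k → ∀ l → 0ℤ ≤ w k l * (c k - c l)
Δ-term-nonneg {w = w} {c} w≥0 {k} max l =
  subst (_≤ w k l * (c k - c l)) (*-zeroʳ (w k l))
    (*-monoˡ-≤-nonNeg (w k l) {{nonNegative (w≥0 k l)}} (i≤j⇒0≤j-i (max l)))

Δ-nonneg : {w : Matrix n} {c : Vector ℤ n} → (∀ k l → 0ℤ ≤ w k l) →
           ∀ {k} → IsMax c k → 0ℤ ≤ Δ w c k
Δ-nonneg {w = w} {c} w≥0 max = sum-nonneg (Δ-term-nonneg {w = w} {c} w≥0 max)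

-- After splitting `Δ`, the two double sums differ only by exchanging `k` and `l`, and `w` is
-- symmetric.
sum-Δ : {w : Matrix n} (c : Vector ℤ n) → (∀ k l → w k l ≡ w l k) → sum (Δ w c) ≡ 0ℤ
sum-Δ {w = w} c w-sym = begin
  sum (Δ w c)  ≡⟨ sum-cong-≗ (Δ-split w c) ⟩
  sum (λ k → sum (λ l → w k l * c k) - sum (λ l → w k l * c l))
               ≡⟨ sum-- (λ k → sum (λ l → w k l * c k)) _ ⟩
  sum (λ k → sum (λ l → w k l * c k)) - sum (λ k → sum (λ l → w k l * c l))
               ≡⟨ i≡j⇒i-j≡0 (trans (∑-comm (λ k l → w k l * c k))
                    (sum-cong-≗ (λ l → sum-cong-≗ (λ k → cong (_* c k) (w-sym k l))))) ⟩
  0ℤ ∎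
  where open ≡-Reasoning

-- For the weights of a simple graph this also puts a loop of weight 1 at every vertex. Loops do not
-- affect `Δ`, since their terms contain `c k - c k`.
complement : Matrix n → Matrix n
complement w k l = 1ℤ - w k l

-- The weights `w` and `complement w` add up to the all-ones matrix, whose `Δ` at `k` is
-- `+ n * c k - sum c`.
Δ-complement : (w : Matrix n) (c : Vector ℤ n) → sum c ≡ 0ℤ →
               ∀ k → Δ (complement w) c k ≡ + n * c k - Δ w c k
Δ-complement {n} w c Σc≡0 k = begin
  Δ (complement w) c k
    ≡⟨ sum-cong-≗ (λ l → expand (w k l) (c k) (c l)) ⟩
  sum (λ l → c k - c l - w k l * (c k - c l))
    ≡⟨ sum-- (λ l → c k - c l) (λ l → w k l * (c k - c l)) ⟩
  sum (λ l → c k - c l) - Δ w c k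
    ≡⟨ cong (_- Δ w c k) (sum-- (λ _ → c k) c) ⟩
  sum {n} (λ _ → c k) - sum c - Δ w c k
    ≡⟨ cong₂ (λ x y → x - y - Δ w c k) (sum-const n (c k)) Σc≡0 ⟩
  + n * c k - 0ℤ - Δ w c k
    ≡⟨ cong (_- Δ w c k) (+-identityʳ (+ n * c k)) ⟩
  + n * c k - Δ w c k ∎
  where
  open ≡-Reasoning
  expand : ∀ a x y → (1ℤ - a) * (x - y) ≡ x - y - a * (x - y)
  expand = solve-∀

-- Standard basis vectors and counting.

e-diag : (k : Fin n) → e k k ≡ 1ℤ
e-diag k with k ≟ k
... | yes _  = refl
... | no k≢k = contradiction refl k≢k

e-off : {k l : Fin n} → k ≢ l → e k l ≡ 0ℤ
e-off {k = k} {l} k≢l with k ≟ l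
... | yes k≡l = contradiction k≡l k≢l
... | no _    = refl

e-e≤1 : (i j k : Fin n) → e i k - e j k ≤ 1ℤ
e-e≤1 i j k with does (i ≟ k) | does (j ≟ k)
... | true  | true  = +≤+ z≤n
... | true  | false = ≤-refl
... | false | true  = -≤+
... | false | false = +≤+ z≤n

0<e-e⇒≡ : (i j k : Fin n) → 0ℤ < e i k - e j k → i ≡ k
0<e-e⇒≡ i j k p with i ≟ k | does (j ≟ k)
... | yes i≡k | _ = i≡k
0<e-e⇒≡ i j k () | no _ | true
0<e-e⇒≡ i j k (+<+ ()) | no _ | false

sum-e≡1 : (k : Fin n) → sum (e k) ≡ 1ℤ
sum-e≡1 k = trans (sum-cong-≗ (λ l → sym (*-identityʳ (e k l)))) (sum-e k (λ _ → 1ℤ))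

-- The map `f` is general so that the induction can pass to `f ∘ suc`; `f = id` gives the degree as
-- a row sum of 0/1 weights.
count-tabulate : ∀ {A : Set} {P : A → Set} (P? : Decidable P) (f : Fin n → A) →
                 + count P? (Vec.tabulate f) ≡ sum (λ l → if does (P? (f l)) then 1ℤ else 0ℤ)
count-tabulate {zero}  P? f = refl
count-tabulate {suc n} P? f with does (P? (f zero))
... | true  = cong (_+_ 1ℤ) (count-tabulate P? (f ∘ suc))
... | false = trans (count-tabulate P? (f ∘ suc)) (sym (+-identityˡ _))

-- The graph Laplacian as `Δ` of the 0/1 adjacency weights.

module _ {n : ℕ} (G : SimpleGraph n) where
  open SimpleGraph G

  adjacency : Matrix n
  adjacency k l = if does (adj? k l) then 1ℤ else 0ℤ

  adjacency≥0 : ∀ k l → 0ℤ ≤ adjacency k l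
  adjacency≥0 k l with does (adj? k l)
  ... | true  = +≤+ z≤n
  ... | false = ≤-refl

  complement-adjacency≥0 : ∀ k l → 0ℤ ≤ complement adjacency k l
  complement-adjacency≥0 k l with does (adj? k l)
  ... | true  = ≤-refl
  ... | false = +≤+ z≤n

  adjacency-sym : ∀ k l → adjacency k l ≡ adjacency l k
  adjacency-sym k l with adj? k l | adj? l k
  ... | yes _  | yes _  = refl
  ... | yes kl | no ¬lk = contradiction (symm kl) ¬lk
  ... | no ¬kl | yes lk = contradiction (symm lk) ¬kl
  ... | no _   | no _   = refl

  adj⇒adjacency≡1 : ∀ {k l} → Adj k l → adjacency k l ≡ 1ℤ
  adj⇒adjacency≡1 {k} {l} kl with adj? k l
  ... | yes _  = refl
  ... | no ¬kl = contradiction kl ¬kl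

  -- The right side is shaped for summation over `l`: `sum-e` extracts the diagonal part, and the
  -- rest is the second sum in `Δ-split`. On the diagonal, irreflexivity makes the adjacency weight
  -- zero.
  laplacian-entry : ∀ μ k l x → x * (laplacian ⊖ μ · Id) k l ≡
                    e k l * ((+ degree k - μ) * x) - adjacency k l * x
  laplacian-entry μ k l x with k ≟ l
  laplacian-entry μ k .k x | yes refl with adj? k k
  ... | yes kk = contradiction kk (irrefl refl)
  ... | no _   = diag x (+ degree k) μ
    where
    diag : ∀ x d μ → x * (d - μ * 1ℤ) ≡ 1ℤ * ((d - μ) * x) - 0ℤ * x
    diag = solve-∀
  laplacian-entry μ k l x | no _ with does (adj? k l)
  ... | true  = off (+ degree k) x μ
    where
    off : ∀ d x μ → x * (-1ℤ - μ * 0ℤ) ≡ 0ℤ * ((d - μ) * x) - 1ℤ * x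
    off = solve-∀
  ... | false = off (+ degree k) x μ
    where
    off : ∀ d x μ → x * (0ℤ - μ * 0ℤ) ≡ 0ℤ * ((d - μ) * x) - 0ℤ * x
    off = solve-∀

  laplacian-row : ∀ μ (c : Vector ℤ n) k →
                  sum (λ l → c l * (laplacian ⊖ μ · Id) k l) ≡ Δ adjacency c k - μ * c k
  laplacian-row μ c k = begin
    sum (λ l → c l * (laplacian ⊖ μ · Id) k l)
      ≡⟨ sum-cong-≗ (λ l → laplacian-entry μ k l (c l)) ⟩
    sum (λ l → e k l * ((+ degree k - μ) * c l) - adjacency k l * c l)
      ≡⟨ sum-- (λ l → e k l * ((+ degree k - μ) * c l)) _ ⟩
    sum (λ l → e k l * ((+ degree k - μ) * c l)) - Σac
      ≡⟨ cong (_- Σac) (sum-e k _) ⟩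
    (+ degree k - μ) * c k - Σac
      ≡⟨ rearrange (+ degree k) μ (c k) Σac ⟩
    + degree k * c k - Σac - μ * c k
      ≡⟨ cong (λ d → d * c k - Σac - μ * c k) (count-tabulate (adj? k) id) ⟩
    sum (adjacency k) * c k - Σac - μ * c k
      ≡⟨ cong (λ s → s - Σac - μ * c k) (*-distribʳ-sum (c k) (adjacency k)) ⟩
    sum (λ l → adjacency k l * c k) - Σac - μ * c k
      ≡⟨ cong (_- μ * c k) (sym (Δ-split adjacency c k)) ⟩
    Δ adjacency c k - μ * c k ∎
    where
    open ≡-Reasoning
    Σac : ℤ
    Σac = sum (λ l → adjacency k l * c l)
    rearrange : ∀ d μ x s → (d - μ) * x - s ≡ d * x - s - μ * x
    rearrange = solve-∀

  -- Consequences of a solution `c` of (L - μ) c = eᵢ - eⱼ with i ≠ j.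

  module _ {μ : ℤ} {i j : Fin n} {c : Vector ℤ n} (i≢j : i ≢ j)
           (eq : ∀ k → e i k - e j k ≡ Δ adjacency c k - μ * c k) where

    μ≢0⇒sum≡0 : μ ≢ 0ℤ → sum c ≡ 0ℤ
    μ≢0⇒sum≡0 μ≢0 with i*j≡0⇒i≡0∨j≡0 μ (neg-injective μΣc≡0)
      where
      open ≡-Reasoning
      μΣc≡0 : - (μ * sum c) ≡ 0ℤ
      μΣc≡0 = begin
        - (μ * sum c)                            ≡⟨ +-identityˡ _ ⟨
        0ℤ - μ * sum c                           ≡⟨ cong₂ _-_ (sym (sum-Δ c adjacency-sym)) (*-distribˡ-sum μ c) ⟩
        sum (Δ adjacency c) - sum (λ k → μ * c k) ≡⟨ sum-- (Δ adjacency c) _ ⟨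
        sum (λ k → Δ adjacency c k - μ * c k)    ≡⟨ sum-cong-≗ eq ⟨
        sum (λ k → e i k - e j k)                ≡⟨ sum-- (e i) (e j) ⟩
        sum (e i) - sum (e j)                    ≡⟨ cong₂ _-_ (sum-e≡1 i) (sum-e≡1 j) ⟩
        0ℤ ∎
    ... | inj₁ μ≡0  = contradiction μ≡0 μ≢0
    ... | inj₂ Σc≡0 = Σc≡0

    not-all-zero : ¬ (∀ k → c k ≡ 0ℤ)
    not-all-zero c≡0 = contradiction (begin
      1ℤ                         ≡⟨ cong₂ _-_ (e-diag i) (e-off (i≢j ∘ sym)) ⟨
      e i i - e j i              ≡⟨ eq i ⟩
      Δ adjacency c i - μ * c i  ≡⟨ cong₂ _-_ (sum-zero λ l → trans
                                     (cong₂ (λ x y → adjacency i l * (x - y)) (c≡0 i) (c≡0 l))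
                                     (*-zeroʳ (adjacency i l)))
                                   (trans (cong (μ *_) (c≡0 i)) (*-zeroʳ μ)) ⟩
      0ℤ ∎) λ ()
      where open ≡-Reasoning

    -- The absurdity of `c = 0` in contrapositive form: both ranges of `μ` are refuted by starting
    -- from a positive maximum.
    max-positive : μ ≢ 0ℤ → ∀ {k} → IsMax c k → 0ℤ < c k
    max-positive μ≢0 {k} max = ≰⇒> λ ck≤0 →
      not-all-zero (max≤0∧sum≡0⇒zero max ck≤0 (μ≢0⇒sum≡0 μ≢0))

    μ-not-negative : Connected → ¬ (μ < 0ℤ)
    μ-not-negative connected μ<0 = no-neighbour (connected i j)
      where
      -- Integrality turns `μ < 0ℤ` into 1 ≤ -μ, which is then multiplied by the positive number
      -- `c k`.
      max≤-μmax : ∀ {k} → IsMax c k → c k ≤ - (μ * c k)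
      max≤-μmax {k} max = begin
        c k           ≡⟨ *-identityˡ (c k) ⟨
        1ℤ * c k      ≤⟨ *-monoʳ-≤-nonNeg (c k) {{nonNegative (<⇒≤ (max-positive (<⇒≢ μ<0) max))}}
                           (i<j⇒suc[i]≤j (neg-mono-< μ<0)) ⟩
        - μ * c k     ≡⟨ neg-distribˡ-* μ (c k) ⟨
        - (μ * c k)   ∎
        where open ≤-Reasoning

      1≤-μmax : ∀ {k} → IsMax c k → 1ℤ ≤ - (μ * c k)
      1≤-μmax max = ≤-trans (i<j⇒suc[i]≤j (max-positive (<⇒≢ μ<0) max)) (max≤-μmax max)

      -- At a maximum, `Δ` is at least 0 and `- (μ * c k)` at least 1, so the coordinate of eᵢ - eⱼ
      -- is positive, which happens only at `i`.
      max⇒source : ∀ {k} → IsMax c k → i ≡ k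
      max⇒source {k} max = 0<e-e⇒≡ i j k (subst (0ℤ <_) (sym (eq k))
        (suc[i]≤j⇒i<j (+-mono-≤ (Δ-nonneg {w = adjacency} adjacency≥0 max) (1≤-μmax max))))

      -- The coordinate of eᵢ - eⱼ is at most 1, and `- (μ * c k)` already accounts for 1.
      max⇒Δ≤0 : ∀ {k} → IsMax c k → Δ adjacency c k ≤ 0ℤ
      max⇒Δ≤0 {k} max = begin
        Δ adjacency c k                              ≡⟨ cancel (Δ adjacency c k) (μ * c k) ⟩
        (Δ adjacency c k - μ * c k) - - (μ * c k)    ≡⟨ cong (_- - (μ * c k)) (eq k) ⟨
        (e i k - e j k) - - (μ * c k)                ≤⟨ +-mono-≤ (e-e≤1 i j k) (neg-mono-≤ (1≤-μmax max)) ⟩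
        0ℤ ∎
        where
        open ≤-Reasoning
        cancel : ∀ x y → x ≡ (x - y) - - y
        cancel = solve-∀

      -- Equality case of the maximum principle: the terms of `Δ` are nonnegative with sum at most
      -- 0, so each vanishes, and an edge has weight 1.
      max⇒neighbour-max : ∀ {k l} → Adj k l → IsMax c k → IsMax c l
      max⇒neighbour-max {k} {l} kl max m = subst (c m ≤_) ck≡cl (max m)
        where
        ck≡cl : c k ≡ c l
        ck≡cl = i-j≡0⇒i≡j (c k) (c l) (trans (sym (*-identityˡ _))
          (trans (cong (_* (c k - c l)) (sym (adj⇒adjacency≡1 kl)))
            (nonneg-sum≤0⇒zero (Δ-term-nonneg {w = adjacency} adjacency≥0 max) (max⇒Δ≤0 max) l)))

      i-max : IsMax c i
      i-max with argmax′ i c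
      ... | k , max = subst (IsMax c) (sym (max⇒source max)) max

      no-neighbour : ¬ Star Adj i j
      no-neighbour ε        = i≢j refl
      -- The first edge of a path from `i` to `j` ends at another maximum, which must be `i` itself;
      -- the edge would be a loop.
      no-neighbour (il ◅ _) = irrefl (max⇒source (max⇒neighbour-max il i-max)) il

    -- The quantity `(μ - + n) * c k` at a maximum is at least 2 by integrality and at most 1 by the
    -- maximum principle for the complement.
    μ-not-large : ¬ (+ suc n < μ)
    μ-not-large 1+n<μ with argmax′ i c
    ... | k , max = contradiction (≤-trans 2≤ ≤1) λ { (+≤+ (s≤s ())) }
      where
      μ≢0 : μ ≢ 0ℤ
      μ≢0 refl = contradiction 1+n<μ λ { (+<+ ()) }

      2≤μ-n : + 2 ≤ μ - + n
      2≤μ-n = begin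
        + 2                  ≡⟨ cancel (+ n) ⟩
        -- By integrality, n + 1 < μ means n + 2 ≤ μ; this is where the bound n + 1 provides the
        -- factor 2.
        (+ 2 + + n) - + n    ≤⟨ +-monoˡ-≤ (- + n) (i<j⇒suc[i]≤j 1+n<μ) ⟩
        μ - + n ∎
        where
        open ≤-Reasoning
        cancel : ∀ x → + 2 ≡ (+ 2 + x) - x
        cancel = solve-∀

      2≤ : + 2 ≤ (μ - + n) * c k
      2≤ = begin
        + 2 * 1ℤ             ≤⟨ *-monoˡ-≤-nonNeg (+ 2) (i<j⇒suc[i]≤j (max-positive μ≢0 max)) ⟩
        + 2 * c k            ≤⟨ *-monoʳ-≤-nonNeg (c k) {{nonNegative (<⇒≤ (max-positive μ≢0 max))}} 2≤μ-n ⟩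
        (μ - + n) * c k ∎
        where open ≤-Reasoning

      ≤1 : (μ - + n) * c k ≤ 1ℤ
      ≤1 = begin
        (μ - + n) * c k                            ≤⟨ i≤j+i _ _ {{nonNegative (Δ-nonneg {w = complement adjacency} complement-adjacency≥0 max)}} ⟩
        Δ (complement adjacency) c k + (μ - + n) * c k
          ≡⟨ cong (_+ (μ - + n) * c k) (Δ-complement adjacency c (μ≢0⇒sum≡0 μ≢0) k) ⟩
        + n * c k - Δ adjacency c k + (μ - + n) * c k
          -- The multiples of `n` cancel, leaving the negated coordinate of (L - μ) c.
          ≡⟨ rearrange (+ n) (c k) (Δ adjacency c k) μ ⟩
        - (Δ adjacency c k - μ * c k)              ≡⟨ cong -_ (eq k) ⟨
        - (e i k - e j k)                          ≡⟨ swap (e i k) (e j k) ⟩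
        e j k - e i k                              ≤⟨ e-e≤1 j i k ⟩
        1ℤ ∎
        where
        open ≤-Reasoning
        rearrange : ∀ n x d μ → n * x - d + (μ - n) * x ≡ - (d - μ * x)
        rearrange = solve-∀
        swap : ∀ x y → - (x - y) ≡ y - x
        swap = solve-∀

theorem3p1 : (n : ℕ) (G : SimpleGraph n) → SimpleGraph.Connected G →
    (μ : ℤ) → ¬ (0ℤ ≤ μ × μ ≤ + suc n) →
    ¬ Collapsed μ (SimpleGraph.laplacian G) × Spread (SimpleGraph.laplacian G ⊖ μ · Id)
theorem3p1 n G connected μ μ∉ = (λ collapsed → collapsed spread) , spread
  where
  spread : Spread (SimpleGraph.laplacian G ⊖ μ · Id)
  spread {i} {j} (c , eq) with i ≟ j
  ... | yes i≡j = i≡j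
  -- Refuting `i ≢ j` suffices: such a solution would put `μ` in [0, n + 1].
  ... | no i≢j  = contradiction (0≤μ , μ≤1+n) μ∉
    where
    eq′ : ∀ k → e i k - e j k ≡ Δ (adjacency G) c k - μ * c k
    eq′ k = trans (eq k) (laplacian-row G μ c k)
    0≤μ : 0ℤ ≤ μ
    0≤μ = ≮⇒≥ (μ-not-negative G i≢j eq′ connected)
    μ≤1+n : μ ≤ + suc n
    μ≤1+n = ≮⇒≥ (μ-not-large G i≢j eq′)
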